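{- Let $C$ be an extended linear code of length $d+1$ over $\mathbb{Z}_N$ and let $g=(g_{ji})$ be a generating matrix of $C$, with $m$ rows and with columns indexed by $i=0,\dots,d$. Put $\gcd_i=\gcd(g_{1i},\dots,g_{mi},N)$. If the linear code $C$ is thin, then $$\sum_{i=0}^d \gcd\nolimits_i>N.$$
   Context: $\mathbb{Z}_N=\mathbb{Z}/N\mathbb{Z}$; its elements are identified with the representatives $0,1,\dots,N-1$, and gcd's are taken of these integers. A linear code of length $n$ over $\mathbb{Z}_N$ is a submodule $C\subseteq\mathbb{Z}_N^n$; its elements are called words; a generating matrix is a matrix whose rows generate $C$. $C$ is extended if every word has coordinate sum $0\bmod N$. An extended code is thin if it contains no word of maximal weight, i.e. no word all of whose entries are nonzero.
   Formalization: The formal statement assumes d ≥ 1: for d = 0 an extended code of length 1 is {0}, which is thin, and gcd_0 = N, so the sum equals N and the strict inequality fails. -}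

module Defs where

open import Algebra.Bundles using (Ring; CommutativeRing)
open import Algebra.Module.Bundles using (LeftModule)
import Algebra.Construct.Pointwise as Pointwise
import Algebra.Definitions.RawMonoid as RawMonoid
open import Data.Fin.Base using (Fin; toℕ)
open import Data.Fin.Properties using (toℕ-injective; toℕ-fromℕ<; toℕ<n; toℕ≤n)
open import Data.Nat.Base using (ℕ; _+_; _*_; _∸_; _%_; NonZero)
open import Data.Nat.DivMod
  using (_mod_; m%n<n; m*n%n≡0; m<n⇒m%n≡m; n%n≡0; %-distribˡ-+; %-distribˡ-*)
open import Data.Nat.GCD using (gcd)
open import Data.Nat.Properties
  using (+-assoc; +-comm; *-assoc; *-comm; *-identityˡ
        ; *-distribʳ-+; m+[n∸m]≡n)
open import Data.Product.Base using (∃-syntax; _×_; _,_)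
open import Data.Vec.Functional using (Vector; foldr)
open import Level using (Level; _⊔_; 0ℓ) renaming (suc to lsuc)
open import Relation.Binary.PropositionalEquality
  using (_≡_; _≢_; sym; trans; cong; cong₂; isEquivalence; module ≡-Reasoning)
open import Relation.Nullary.Negation using (¬_)
open import Relation.Unary using (Pred; _∈_)

private
  variable
    c ℓ m ℓm p : Level

-- ℤ/Nℤ on the representatives 0, …, N - 1.
module _ (N : ℕ) .{{_ : NonZero N}} where

  infixl 6 _+ₘ_
  infixl 7 _*ₘ_
  infix  8 -ₘ_

  _+ₘ_ _*ₘ_ : Fin N → Fin N → Fin N
  a +ₘ b = (toℕ a + toℕ b) mod N
  a *ₘ b = (toℕ a * toℕ b) mod N

  -ₘ_ : Fin N → Fin N
  -ₘ a = (N ∸ toℕ a) mod N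

  0ₘ 1ₘ : Fin N
  0ₘ = 0 mod N
  1ₘ = 1 mod N

  toℕ-mod : ∀ k → toℕ (k mod N) ≡ k % N
  toℕ-mod k = toℕ-fromℕ< (m%n<n k N)

  mod-toℕ : ∀ (a : Fin N) → toℕ a mod N ≡ a
  mod-toℕ a = toℕ-injective (trans (toℕ-mod (toℕ a)) (m<n⇒m%n≡m (toℕ<n a)))

  mod-cong : ∀ {j k} → j % N ≡ k % N → j mod N ≡ k mod N
  mod-cong {j} {k} eq = toℕ-injective (trans (toℕ-mod j) (trans eq (sym (toℕ-mod k))))

  mod-homo-+ : ∀ j k → (j mod N) +ₘ (k mod N) ≡ (j + k) mod N
  mod-homo-+ j k = mod-cong (trans
    (cong₂ (λ x y → (x + y) % N) (toℕ-mod j) (toℕ-mod k))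
    (sym (%-distribˡ-+ j k N)))

  mod-homo-* : ∀ j k → (j mod N) *ₘ (k mod N) ≡ (j * k) mod N
  mod-homo-* j k = mod-cong (trans
    (cong₂ (λ x y → (x * y) % N) (toℕ-mod j) (toℕ-mod k))
    (sym (%-distribˡ-* j k N)))

  private
    open ≡-Reasoning

    +ₘ-assoc : ∀ a b c → (a +ₘ b) +ₘ c ≡ a +ₘ (b +ₘ c)
    +ₘ-assoc a b c = begin
      (a +ₘ b) +ₘ c                       ≡⟨ cong ((a +ₘ b) +ₘ_) (mod-toℕ c) ⟨
      (a +ₘ b) +ₘ (toℕ c mod N)           ≡⟨ mod-homo-+ (toℕ a + toℕ b) (toℕ c) ⟩
      (toℕ a + toℕ b + toℕ c) mod N       ≡⟨ cong (_mod N) (+-assoc (toℕ a) (toℕ b) (toℕ c)) ⟩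
      (toℕ a + (toℕ b + toℕ c)) mod N     ≡⟨ mod-homo-+ (toℕ a) (toℕ b + toℕ c) ⟨
      (toℕ a mod N) +ₘ (b +ₘ c)           ≡⟨ cong (_+ₘ (b +ₘ c)) (mod-toℕ a) ⟩
      a +ₘ (b +ₘ c)                       ∎

    *ₘ-assoc : ∀ a b c → (a *ₘ b) *ₘ c ≡ a *ₘ (b *ₘ c)
    *ₘ-assoc a b c = begin
      (a *ₘ b) *ₘ c                       ≡⟨ cong ((a *ₘ b) *ₘ_) (mod-toℕ c) ⟨
      (a *ₘ b) *ₘ (toℕ c mod N)           ≡⟨ mod-homo-* (toℕ a * toℕ b) (toℕ c) ⟩
      (toℕ a * toℕ b * toℕ c) mod N       ≡⟨ cong (_mod N) (*-assoc (toℕ a) (toℕ b) (toℕ c)) ⟩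
      (toℕ a * (toℕ b * toℕ c)) mod N     ≡⟨ mod-homo-* (toℕ a) (toℕ b * toℕ c) ⟨
      (toℕ a mod N) *ₘ (b *ₘ c)           ≡⟨ cong (_*ₘ (b *ₘ c)) (mod-toℕ a) ⟩
      a *ₘ (b *ₘ c)                       ∎

    +ₘ-comm : ∀ a b → a +ₘ b ≡ b +ₘ a
    +ₘ-comm a b = cong (_mod N) (+-comm (toℕ a) (toℕ b))

    *ₘ-comm : ∀ a b → a *ₘ b ≡ b *ₘ a
    *ₘ-comm a b = cong (_mod N) (*-comm (toℕ a) (toℕ b))

    +ₘ-identityˡ : ∀ a → 0ₘ +ₘ a ≡ a
    +ₘ-identityˡ a = begin
      0ₘ +ₘ a               ≡⟨ cong (0ₘ +ₘ_) (mod-toℕ a) ⟨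
      0ₘ +ₘ (toℕ a mod N)   ≡⟨ mod-homo-+ 0 (toℕ a) ⟩
      toℕ a mod N           ≡⟨ mod-toℕ a ⟩
      a                     ∎

    *ₘ-identityˡ : ∀ a → 1ₘ *ₘ a ≡ a
    *ₘ-identityˡ a = begin
      1ₘ *ₘ a               ≡⟨ cong (1ₘ *ₘ_) (mod-toℕ a) ⟨
      1ₘ *ₘ (toℕ a mod N)   ≡⟨ mod-homo-* 1 (toℕ a) ⟩
      (1 * toℕ a) mod N     ≡⟨ cong (_mod N) (*-identityˡ (toℕ a)) ⟩
      toℕ a mod N           ≡⟨ mod-toℕ a ⟩
      a                     ∎

    -ₘ-inverseʳ : ∀ a → a +ₘ (-ₘ a) ≡ 0ₘ
    -ₘ-inverseʳ a = begin
      a +ₘ (-ₘ a)                   ≡⟨ cong (_+ₘ (-ₘ a)) (mod-toℕ a) ⟨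
      (toℕ a mod N) +ₘ (-ₘ a)       ≡⟨ mod-homo-+ (toℕ a) (N ∸ toℕ a) ⟩
      (toℕ a + (N ∸ toℕ a)) mod N   ≡⟨ cong (_mod N) (m+[n∸m]≡n (toℕ≤n a)) ⟩
      N mod N                       ≡⟨ mod-cong (trans (n%n≡0 N) (sym (m*n%n≡0 0 N))) ⟩
      0ₘ                            ∎

    *ₘ-distribʳ : ∀ a b c → (b +ₘ c) *ₘ a ≡ (b *ₘ a) +ₘ (c *ₘ a)
    *ₘ-distribʳ a b c = begin
      (b +ₘ c) *ₘ a                               ≡⟨ cong ((b +ₘ c) *ₘ_) (mod-toℕ a) ⟨
      (b +ₘ c) *ₘ (toℕ a mod N)                   ≡⟨ mod-homo-* (toℕ b + toℕ c) (toℕ a) ⟩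
      ((toℕ b + toℕ c) * toℕ a) mod N             ≡⟨ cong (_mod N) (*-distribʳ-+ (toℕ a) (toℕ b) (toℕ c)) ⟩
      (toℕ b * toℕ a + toℕ c * toℕ a) mod N       ≡⟨ mod-homo-+ (toℕ b * toℕ a) (toℕ c * toℕ a) ⟨
      (b *ₘ a) +ₘ (c *ₘ a)                        ∎

  ℤ/ : CommutativeRing 0ℓ 0ℓ
  ℤ/ = record
    { Carrier = Fin N
    ; _≈_     = _≡_
    ; _+_     = _+ₘ_
    ; _*_     = _*ₘ_
    ; -_      = -ₘ_
    ; 0#      = 0ₘ
    ; 1#      = 1ₘ
    ; isCommutativeRing = record
      { isRing = record
        { +-isAbelianGroup = record
          { isGroup = record
            { isMonoid = record
              { isSemigroup = record
                { isMagma = record { isEquivalence = isEquivalence ; ∙-cong = cong₂ _+ₘ_ }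
                ; assoc   = +ₘ-assoc
                }
              ; identity = +ₘ-identityˡ
                         , (λ a → trans (+ₘ-comm a 0ₘ) (+ₘ-identityˡ a))
              }
            ; inverse = (λ a → trans (+ₘ-comm (-ₘ a) a) (-ₘ-inverseʳ a)) , -ₘ-inverseʳ
            ; ⁻¹-cong = cong -ₘ_
            }
          ; comm = +ₘ-comm
          }
        ; *-cong     = cong₂ _*ₘ_
        ; *-assoc    = *ₘ-assoc
        ; *-identity = *ₘ-identityˡ
                     , (λ a → trans (*ₘ-comm a 1ₘ) (*ₘ-identityˡ a))
        ; distrib    = (λ a b c → trans (*ₘ-comm a (b +ₘ c))
                          (trans (*ₘ-distribʳ a b c) (cong₂ _+ₘ_ (*ₘ-comm b a) (*ₘ-comm c a))))
                     , *ₘ-distribʳ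
        }
      ; *-comm = *ₘ-comm
      }
    }

-- Vectors are functions, so equality in the free module is pointwise.
freeModule : (R : Ring c ℓ) → ℕ → LeftModule R c ℓ
freeModule R n = record
  { Carrierᴹ     = Vector R.Carrier n
  ; _≈ᴹ_         = λ v w → ∀ i → v i R.≈ w i
  ; _+ᴹ_         = λ v w i → v i R.+ w i
  ; _*ₗ_         = λ r v i → r R.* v i
  ; 0ᴹ           = λ _ → R.0#
  ; -ᴹ_          = λ v i → R.- v i
  ; isLeftModule = record
    { isLeftSemimodule = record
      { +ᴹ-isCommutativeMonoid = +ᴹ.isCommutativeMonoid
      ; isPreleftSemimodule = record
        { *ₗ-cong      = λ r≈s v≈w i → R.*-cong r≈s (v≈w i)
        ; *ₗ-zeroˡ     = λ v i → R.zeroˡ (v i)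
        ; *ₗ-distribʳ  = λ v r s i → R.distribʳ (v i) r s
        ; *ₗ-identityˡ = λ v i → R.*-identityˡ (v i)
        ; *ₗ-assoc     = λ r s v i → R.*-assoc r s (v i)
        ; *ₗ-zeroʳ     = λ r i → R.zeroʳ r
        ; *ₗ-distribˡ  = λ r v w i → R.distribˡ r (v i) (w i)
        }
      }
    ; -ᴹ‿cong    = +ᴹ.⁻¹-cong
    ; -ᴹ‿inverse = +ᴹ.inverse
    }
  }
  where
  module R = Ring R
  open import Algebra.Structures using (IsAbelianGroup)
  module +ᴹ = IsAbelianGroup (Pointwise.isAbelianGroup (Fin n) R.+-isAbelianGroup)

module _ {R : Ring c ℓ} (M : LeftModule R m ℓm) where
  open Ring R using (Carrier)
  open LeftModule M

  record Submodule p : Set (c ⊔ m ⊔ ℓm ⊔ lsuc p) where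
    field
      Member    : Pred Carrierᴹ p
      ≈-closed  : ∀ {v w} → v ≈ᴹ w → v ∈ Member → w ∈ Member
      0-closed  : 0ᴹ ∈ Member
      +-closed  : ∀ {v w} → v ∈ Member → w ∈ Member → v +ᴹ w ∈ Member
      *ₗ-closed : ∀ r {v} → v ∈ Member → r *ₗ v ∈ Member

  open Submodule

  linearCombination : ∀ {k} → Vector Carrier k → Vector Carrierᴹ k → Carrierᴹ
  linearCombination r g = RawMonoid.sum +ᴹ-rawMonoid (λ j → r j *ₗ g j)

  Generates : ∀ {k} → Vector Carrierᴹ k → Submodule p → Set (c ⊔ m ⊔ ℓm ⊔ p)
  Generates g C =
      (∀ j → g j ∈ Member C)
    × (∀ {w} → w ∈ Member C → ∃[ r ] w ≈ᴹ linearCombination r g)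

module _ (N : ℕ) .{{_ : NonZero N}} where

  private
    ring : Ring 0ℓ 0ℓ
    ring = CommutativeRing.ring (ℤ/ N)

  Word : ℕ → Set
  Word n = Vector (Fin N) n

  LinearCode : ℕ → (p : Level) → Set (lsuc p)
  LinearCode n p = Submodule (freeModule ring n) p

  module _ {n : ℕ} (C : LinearCode n p) where
    open Submodule C

    -- A matrix is the vector of its rows, so the entry g_{ji} is g j i.
    IsGeneratingMatrix : ∀ {k} → Vector (Word n) k → Set p
    IsGeneratingMatrix g = Generates (freeModule ring n) g C

    Extended : Set p
    Extended = ∀ w → w ∈ Member → RawMonoid.sum (Ring.+-rawMonoid ring) w ≡ 0ₘ N

    Thin : Set p
    Thin = ¬ (∃[ w ] w ∈ Member × (∀ i → w i ≢ 0ₘ N))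

  columnGcd : ∀ {k n} → Vector (Word n) k → Fin n → ℕ
  columnGcd g i = foldr gcd N (λ j → toℕ (g j i))

sumℕ : ∀ {n} → Vector ℕ n → ℕ
sumℕ = foldr _+_ 0

{-# OPTIONS --safe #-}
-- The words r · g, for r ranging over the N ^ m coefficient vectors, all lie in C. The i-th
-- entry of r · g is a homomorphism in r whose image is generated by gcd_i, so it vanishes for
-- exactly N ^ m * gcd_i / N of them. As C is thin, every r is counted by some i, and r = 0 is
-- counted by each of the d + 1 ≥ 2 columns; the union bound is therefore strict.
module Submission where

open import Defs
open import Algebra.Bundles using (Ring; CommutativeRing)
open import Algebra.Module.Bundles using (LeftModule)
open import Data.Fin.Base using (Fin; zero; suc; toℕ)
open import Data.Fin.Properties using (any?; toℕ<n)
open import Data.Nat.Base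
  using (ℕ; zero; suc; _+_; _*_; _^_; _≤_; _<_; _>_; z≤n; s≤s; NonZero)
open import Data.Nat.DivMod using (_mod_; m*n%n≡0)
open import Data.Nat.Divisibility
open import Data.Nat.GCD using (gcd; gcd[m,n]∣m; gcd[m,n]∣n; gcd-greatest; c*gcd[m,n]≡gcd[cm,cn])
open import Data.Nat.Properties
open import Data.Nat.Tactic.RingSolver using (solve-∀)
open import Data.Product.Base using (_,_)
open import Data.Vec.Functional using (Vector; foldr; _∷_; tail)
open import Function.Base using (_∘_)
open import Level using (Level)
open import Relation.Binary.PropositionalEquality
  using (_≡_; refl; sym; trans; cong; subst)
open import Relation.Nullary.Decidable using (Dec; yes; no)
open import Relation.Nullary.Negation using (¬_; contradiction)
open import Relation.Unary using (_∈_; Decidable)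
open import Algebra.Properties.Semiring.Sum +-*-semiring
  using (sum; sum-cong-≗; ∑-comm; *-distribˡ-sum; *-distribʳ-sum)

private
  variable
    a p : Level
    A : Set a

sum-mono-≤ : ∀ {n} {f g : Vector ℕ n} → (∀ i → f i ≤ g i) → sum f ≤ sum g
sum-mono-≤ {zero}  f≤g = z≤n
sum-mono-≤ {suc n} f≤g = +-mono-≤ (f≤g zero) (sum-mono-≤ (f≤g ∘ suc))

n*k≤sum : ∀ {n k} {f : Vector ℕ n} → (∀ i → k ≤ f i) → n * k ≤ sum f
n*k≤sum {zero}  k≤f = z≤n
n*k≤sum {suc n} k≤f = +-mono-≤ (k≤f zero) (n*k≤sum (k≤f ∘ suc))

sum≤n*k : ∀ {n k} {f : Vector ℕ n} → (∀ i → f i ≤ k) → sum f ≤ n * k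
sum≤n*k {zero}  f≤k = z≤n
sum≤n*k {suc n} f≤k = +-mono-≤ (f≤k zero) (sum≤n*k (f≤k ∘ suc))

f[i]≤sum : ∀ {n} (f : Vector ℕ n) i → f i ≤ sum f
f[i]≤sum f zero    = m≤m+n (f zero) _
f[i]≤sum f (suc i) = m≤n⇒m≤o+n (f zero) (f[i]≤sum (tail f) i)

𝟙 : Dec A → ℕ
𝟙 (yes _) = 1
𝟙 (no  _) = 0

𝟙-true : (A? : Dec A) → A → 1 ≤ 𝟙 A?
𝟙-true (yes _) _ = ≤-refl
𝟙-true (no ¬a) a = contradiction a ¬a

𝟙-false : (A? : Dec A) → ¬ A → 𝟙 A? ≤ 0
𝟙-false (yes a) ¬a = contradiction a ¬a
𝟙-false (no _)  _  = ≤-refl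

𝟙≤1 : (A? : Dec A) → 𝟙 A? ≤ 1
𝟙≤1 (yes _) = ≤-refl
𝟙≤1 (no _)  = z≤n

sum< : ∀ n → (ℕ → ℕ) → ℕ
sum< n f = sum {n} (f ∘ toℕ)

sum<-+ : ∀ m n f → sum< (m + n) f ≡ sum< m f + sum< n (λ k → f (m + k))
sum<-+ zero    n f = refl
sum<-+ (suc m) n f = trans (cong (f 0 +_) (sum<-+ m n (f ∘ suc))) (sym (+-assoc (f 0) _ _))

sum<-blocks : ∀ e f → (∀ a → sum< e (λ k → f (a + k)) ≤ 1) →
              ∀ q a → sum< (q * e) (λ k → f (a + k)) ≤ q
sum<-blocks e f block zero    a = z≤n
sum<-blocks e f block (suc q) a = begin
  sum< (e + q * e) (λ k → f (a + k))
    ≡⟨ sum<-+ e (q * e) (λ k → f (a + k)) ⟩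
  sum< e (λ k → f (a + k)) + sum< (q * e) (λ k → f (a + (e + k)))
    ≡⟨ cong (sum< e (λ k → f (a + k)) +_)
            (sum-cong-≗ (λ i → cong f (+-assoc a e (toℕ {q * e} i)))) ⟨
  sum< e (λ k → f (a + k)) + sum< (q * e) (λ k → f (a + e + k))
    ≤⟨ +-mono-≤ (block a) (sum<-blocks e f block q (a + e)) ⟩
  suc q ∎
  where open ≤-Reasoning

count≤1 : ∀ n {P : ℕ → Set p} (P? : Decidable P) →
          (∀ {i j} → i < j → j < n → P i → ¬ P j) →
          sum< n (λ k → 𝟙 (P? k)) ≤ 1
count≤1 zero    P? unique = z≤n
count≤1 (suc n) P? unique with P? 0
... | no _   = count≤1 n (P? ∘ suc) (λ i<j j<n → unique (s≤s i<j) (s≤s j<n))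
... | yes p₀ = s≤s (≤-trans
  (sum≤n*k (λ i → 𝟙-false (P? (suc (toℕ i))) (unique (s≤s z≤n) (s≤s (toℕ<n i)) p₀)))
  (≤-reflexive (*-zeroʳ n)))

∣-nonZero : ∀ {d n} → d ∣ n → .{{NonZero n}} → NonZero d
∣-nonZero {d} (divides q n≡q*d) {{n≢0}} =
  m*n≢0⇒n≢0 q {d} {{subst NonZero n≡q*d n≢0}}

-- Two solutions r of D ∣ t + r * c differ by a multiple of D / gcd c D.
count-linear*D≤ : ∀ {N D} .{{_ : NonZero N}} → D ∣ N → ∀ t c →
                  sum< N (λ r → 𝟙 (D ∣? t + r * c)) * D ≤ N * gcd c D
count-linear*D≤ {N} {D} D∣N@(divides q N≡q*D) t c with gcd[m,n]∣n c D
... | g∣D@(divides e D≡e*g) = begin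
  sum< N f * D              ≡⟨ cong (λ n → sum< n f * D) N≡q*g*e ⟩
  sum< (q * g * e) f * D    ≤⟨ *-monoˡ-≤ D (sum<-blocks e f block (q * g) 0) ⟩
  q * g * D                 ≡⟨ swap q g D ⟩
  q * D * g                 ≡⟨ cong (_* g) N≡q*D ⟨
  N * g                     ∎
  where
  open ≤-Reasoning
  g = gcd c D
  f = λ r → 𝟙 (D ∣? t + r * c)

  swap : ∀ x y z → x * y * z ≡ x * z * y
  swap = solve-∀

  N≡q*g*e : N ≡ q * g * e
  N≡q*g*e = trans N≡q*D (trans (cong (q *_) (trans D≡e*g (*-comm e g))) (sym (*-assoc q g e)))

  D∣k*c⇒e∣k : ∀ k → D ∣ k * c → e ∣ k
  D∣k*c⇒e∣k k D∣kc = *-cancelʳ-∣ g {{∣-nonZero (∣-trans g∣D D∣N)}} (subst (_∣ k * g) D≡e*g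
    (subst (D ∣_) (sym (c*gcd[m,n]≡gcd[cm,cn] k c D)) (gcd-greatest D∣kc (n∣m*n k))))

  shift : ∀ t c a i k → t + (a + (i + k)) * c ≡ t + (a + i) * c + k * c
  shift = solve-∀

  block : ∀ a → sum< e (λ k → f (a + k)) ≤ 1
  block a = count≤1 e (λ k → D ∣? t + (a + k) * c) sparse
    where
    sparse : ∀ {i j} → i < j → j < e → D ∣ t + (a + i) * c → ¬ D ∣ t + (a + j) * c
    sparse {i} {j} i<j j<e D∣i D∣j with m≤n⇒∃[o]m+o≡n (<⇒≤ i<j)
    ... | zero  , i+0≡j = <⇒≢ i<j (trans (sym (+-identityʳ i)) i+0≡j)
    ... | suc k , refl  = >⇒∤ (≤-<-trans (m≤n+m (suc k) i) j<e) (D∣k*c⇒e∣k (suc k)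
      (∣m+n∣m⇒∣n (subst (D ∣_) (shift t c a i (suc k)) D∣j) D∣i))

count-linear*D≤𝟙* : ∀ {N D} .{{_ : NonZero N}} → D ∣ N → ∀ t c →
                    sum< N (λ r → 𝟙 (D ∣? t + r * c)) * D ≤ 𝟙 (gcd c D ∣? t) * (N * gcd c D)
count-linear*D≤𝟙* {N} {D} D∣N t c with gcd c D ∣? t
... | yes _  = ≤-trans (count-linear*D≤ D∣N t c) (≤-reflexive (sym (*-identityˡ _)))
... | no g∤t = *-monoˡ-≤ D (≤-trans
  (sum≤n*k {N} (λ r → 𝟙-false (D ∣? t + toℕ r * c) (λ D∣ → g∤t (∣m+n∣m⇒∣n
    (subst (gcd c D ∣_) (+-comm t _) (∣-trans (gcd[m,n]∣n c D) D∣))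
    (∣n⇒∣m*n (toℕ r) (gcd[m,n]∣m c D))))))
  (≤-reflexive (*-zeroʳ N)))

module _ (N : ℕ) .{{_ : NonZero N}} where

  private
    ring = CommutativeRing.ring (ℤ/ N)

  coeffSum : ∀ m → (Vector (Fin N) m → ℕ) → ℕ
  coeffSum zero    f = f (λ ())
  coeffSum (suc m) f = sum (λ a → coeffSum m (λ r → f (a ∷ r)))

  coeffSum-cong : ∀ m {f g} → (∀ r → f r ≡ g r) → coeffSum m f ≡ coeffSum m g
  coeffSum-cong zero    f≡g = f≡g _
  coeffSum-cong (suc m) f≡g = sum-cong-≗ (λ a → coeffSum-cong m (λ r → f≡g (a ∷ r)))

  coeffSum-sum : ∀ m {n} (f : Vector (Fin N) m → Vector ℕ n) →
                 coeffSum m (λ r → sum (f r)) ≡ sum (λ i → coeffSum m (λ r → f r i))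
  coeffSum-sum zero    f = refl
  coeffSum-sum (suc m) f = trans
    (sum-cong-≗ (λ a → coeffSum-sum m (λ r → f (a ∷ r))))
    (∑-comm (λ a i → coeffSum m (λ r → f (a ∷ r) i)))

  N^m≤coeffSum : ∀ m {f} → (∀ r → 1 ≤ f r) → N ^ m ≤ coeffSum m f
  N^m≤coeffSum zero    1≤f = 1≤f _
  N^m≤coeffSum (suc m) 1≤f = n*k≤sum {N} (λ a → N^m≤coeffSum m (λ r → 1≤f (a ∷ r)))

  dot : ∀ {m} → Vector (Fin N) m → Vector (Fin N) m → ℕ
  dot r c = sum (λ j → toℕ (r j) * toℕ (c j))

  -- The factor 𝟙 (D ∣? t) makes the first coefficient of the next induction step satisfy a
  -- linear congruence modulo D.
  N*count-dot≤ : ∀ m t (c : Vector (Fin N) m) → let D = foldr gcd N (toℕ ∘ c) in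
                 N * coeffSum m (λ r → 𝟙 (N ∣? t + dot r c)) ≤ 𝟙 (D ∣? t) * (D * N ^ m)
  N*count-dot≤ zero t c rewrite +-identityʳ t | *-identityʳ N = ≤-reflexive (*-comm N _)
  N*count-dot≤ (suc m) t c = begin
    N * sum {N} (λ a → coeffSum m (λ r → 𝟙 (N ∣? t + dot (a ∷ r) c)))
      ≡⟨ *-distribˡ-sum {N} N (λ a → coeffSum m (λ r → 𝟙 (N ∣? t + dot (a ∷ r) c))) ⟩
    sum {N} (λ a → N * coeffSum m (λ r → 𝟙 (N ∣? t + dot (a ∷ r) c)))
      ≡⟨ sum-cong-≗ {N} (λ a → cong (N *_) (coeffSum-cong m
           (λ r → cong (λ x → 𝟙 (N ∣? x)) (+-assoc t (toℕ a * c₀) (dot r (tail c)))))) ⟨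
    sum {N} (λ a → N * coeffSum m (λ r → 𝟙 (N ∣? t + toℕ a * c₀ + dot r (tail c))))
      ≤⟨ sum-mono-≤ {N} (λ a → N*count-dot≤ m (t + toℕ a * c₀) (tail c)) ⟩
    sum {N} (λ a → 𝟙 (D ∣? t + toℕ a * c₀) * (D * N ^ m))
      ≡⟨ *-distribʳ-sum {N} (D * N ^ m) (λ a → 𝟙 (D ∣? t + toℕ a * c₀)) ⟨
    solutions * (D * N ^ m)
      ≡⟨ *-assoc solutions D (N ^ m) ⟨
    solutions * D * N ^ m
      ≤⟨ *-monoˡ-≤ (N ^ m) (count-linear*D≤𝟙* (foldr-gcd∣ (tail c)) t c₀) ⟩
    𝟙 (gcd c₀ D ∣? t) * (N * gcd c₀ D) * N ^ m
      ≡⟨ rearrange (𝟙 (gcd c₀ D ∣? t)) N (gcd c₀ D) (N ^ m) ⟩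
    𝟙 (gcd c₀ D ∣? t) * (gcd c₀ D * (N * N ^ m)) ∎
    where
    open ≤-Reasoning
    c₀ = toℕ (c zero)
    D  = foldr gcd N (toℕ ∘ tail c)
    solutions = sum< N (λ a → 𝟙 (D ∣? t + a * c₀))

    rearrange : ∀ b x y z → b * (x * y) * z ≡ b * (y * (x * z))
    rearrange = solve-∀

    foldr-gcd∣ : ∀ {n} (c : Vector (Fin N) n) → foldr gcd N (toℕ ∘ c) ∣ N
    foldr-gcd∣ {zero}  c = ∣-refl
    foldr-gcd∣ {suc n} c = ∣-trans (gcd[m,n]∣n (toℕ (c zero)) _) (foldr-gcd∣ (tail c))

  linearCombination-lookup :
    ∀ {m n} (r : Vector (Fin N) m) (g : Vector (Word N n) m) i →
    linearCombination (freeModule ring n) r g i ≡ dot r (λ j → g j i) mod N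
  linearCombination-lookup {zero}  r g i = refl
  linearCombination-lookup {suc m} r g i = trans
    (cong (_+ₘ_ N _) (linearCombination-lookup (tail r) (tail g) i))
    (mod-homo-+ N (toℕ (r zero) * toℕ (g zero i)) _)

  mod≡0ₘ⇒∣ : ∀ k → k mod N ≡ 0ₘ N → N ∣ k
  mod≡0ₘ⇒∣ k eq = m%n≡0⇒n∣m k N (trans (sym (toℕ-mod N k))
    (trans (cong toℕ eq) (trans (toℕ-mod N 0) (m*n%n≡0 0 N))))

N^m<coeffSum : ∀ N .{{_ : NonZero N}} m {f} → (∀ r → 1 ≤ f r) →
               (∀ r → (∀ j → toℕ (r j) ≡ 0) → 2 ≤ f r) → N ^ m < coeffSum N m f
N^m<coeffSum N       zero    1≤f 2≤f = 2≤f _ (λ ())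
N^m<coeffSum (suc n) (suc m) 1≤f 2≤f = +-mono-<-≤
  (N^m<coeffSum (suc n) m (λ r → 1≤f (zero ∷ r))
    (λ r r≡0 → 2≤f (zero ∷ r) λ { zero → refl ; (suc j) → r≡0 j }))
  (n*k≤sum (λ a → N^m≤coeffSum (suc n) m (λ r → 1≤f (suc a ∷ r))))

module _ {c ℓ m ℓm} {R : Ring c ℓ} {M : LeftModule R m ℓm} (C : Submodule M p) where
  open Submodule C

  linearCombination-closed : ∀ {k} r (g : Vector (LeftModule.Carrierᴹ M) k) →
                             (∀ j → g j ∈ Member) → linearCombination M r g ∈ Member
  linearCombination-closed {zero}  r g g∈C = 0-closed
  linearCombination-closed {suc k} r g g∈C = +-closed (*ₗ-closed (r zero) (g∈C zero))
    (linearCombination-closed (tail r) (tail g) (g∈C ∘ suc))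

proposition2p12 : ∀ {p : Level} (N : ℕ) .{{_ : NonZero N}} (d : ℕ) → 1 ≤ d →
    (C : LinearCode N (suc d) p) → Extended N C →
    (m : ℕ) (g : Vector (Word N (suc d)) m) → IsGeneratingMatrix N C g →
    Thin N C →
    sumℕ (λ i → columnGcd N g i) > N
proposition2p12 N d 1≤d C _ m g (g∈C , _) thin = *-cancelʳ-< (N ^ m) N (sumℕ gcds) (begin-strict
  N * N ^ m
    <⟨ *-monoʳ-< N (N^m<coeffSum N m vanishes-somewhere zero-vanishes-twice) ⟩
  N * coeffSum N m (λ r → sum (vanishes r))
    ≡⟨ cong (N *_) (coeffSum-sum N m vanishes) ⟩
  N * sum (λ i → coeffSum N m (λ r → vanishes r i))
    ≡⟨ *-distribˡ-sum N (λ i → coeffSum N m (λ r → vanishes r i)) ⟩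
  sum (λ i → N * coeffSum N m (λ r → vanishes r i))
    ≤⟨ sum-mono-≤ {suc d} column-bound ⟩
  sum (λ i → gcds i * N ^ m)
    ≡⟨ *-distribʳ-sum (N ^ m) gcds ⟨
  sumℕ gcds * N ^ m ∎)
  where
  open ≤-Reasoning

  gcds : Vector ℕ (suc d)
  gcds = columnGcd N g

  vanishes? : ∀ r i → Dec (N ∣ dot N r (λ j → g j i))
  vanishes? r i = N ∣? dot N r (λ j → g j i)

  vanishes : Vector (Fin N) m → Vector ℕ (suc d)
  vanishes r i = 𝟙 (vanishes? r i)

  column-bound : ∀ i → N * coeffSum N m (λ r → vanishes r i) ≤ gcds i * N ^ m
  column-bound i = begin
    N * coeffSum N m (λ r → vanishes r i)     ≤⟨ N*count-dot≤ N m 0 (λ j → g j i) ⟩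
    𝟙 (gcds i ∣? 0) * (gcds i * N ^ m)        ≤⟨ *-monoˡ-≤ _ (𝟙≤1 (gcds i ∣? 0)) ⟩
    1 * (gcds i * N ^ m)                      ≡⟨ *-identityˡ _ ⟩
    gcds i * N ^ m                            ∎

  vanishes-somewhere : ∀ r → 1 ≤ sum (vanishes r)
  vanishes-somewhere r with any? (vanishes? r)
  ... | yes (i , N∣) = ≤-trans (𝟙-true (vanishes? r i) N∣) (f[i]≤sum (vanishes r) i)
  ... | no  nowhere  = contradiction
    (_ , linearCombination-closed C r g g∈C , λ i ≡0 → nowhere (i ,
      mod≡0ₘ⇒∣ N _ (trans (sym (linearCombination-lookup N r g i)) ≡0)))
    thin

  zero-vanishes-twice : ∀ r → (∀ j → toℕ (r j) ≡ 0) → 2 ≤ sum (vanishes r)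
  zero-vanishes-twice r r≡0 = ≤-trans (s≤s 1≤d) (≤-trans (≤-reflexive (sym (*-identityʳ (suc d))))
    (n*k≤sum {suc d} (λ i → 𝟙-true (vanishes? r i) (subst (N ∣_) (sym (dot≡0 i)) (N ∣0)))))
    where
    dot≡0 : ∀ i → dot N r (λ j → g j i) ≡ 0
    dot≡0 i = n≤0⇒n≡0 (≤-trans
      (sum≤n*k {m} (λ j → ≤-reflexive (cong (_* toℕ (g j i)) (r≡0 j))))
      (≤-reflexive (*-zeroʳ m)))
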